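{- For every finite request sequence, the total flow time of the schedule produced by the algorithm $\mathrm{LWF}_5$ (longest-wait-first with speed $5$) is at most $90$ times the total flow time of an optimal $1$-speed offline schedule: $\mathrm{LWF}_5 \le 90\,\mathrm{OPT}$.
   Context: Broadcast scheduling, discrete time. There are $n$ unit-sized pages. $J_{p,i}$ denotes the $i$-th request for page $p\in\{1,\dots,n\}$; it arrives at an integer time $a_{p,i}$. At each integer time $t$ the following happen in this order: the scheduler chooses pages and broadcasts them, and all outstanding requests for these pages are satisfied and get finish time $t$; then new requests arrive. Hence a request arriving at time $t$ is not satisfied by a broadcast at time $t$, and the finish time $f_{p,i}$ of $J_{p,i}$ is the earliest integer time strictly after $a_{p,i}$ at which $p$ is broadcast. A schedule with integer speed $s$ broadcasts at most $s$ pages at each integer time. The total flow time of a schedule is $\sum_{p}\sum_i (f_{p,i}-a_{p,i})$. $\mathrm{OPT}$ denotes the minimum total flow time of a $1$-speed offline schedule for the request sequence. Algorithm $\mathrm{LWF}_s$: at each integer time $t$, letting $U(t)$ be the set of requests that have arrived and are unsatisfied at time $t$, broadcast the $s$ pages $p$ with the largest waiting times $\sum_{J_{p,i}\in U(t)}(t-a_{p,i})$ (ties broken arbitrarily; if fewer than $s$ pages have outstanding requests, all of these are broadcast). $\mathrm{LWF}_s$ also denotes the total flow time of its schedule. -}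

module Defs where

open import Algebra.Properties.Semiring.Sum using (sum)
open import Data.Bool.Base using (if_then_else_)
open import Data.Fin.Base using (Fin)
open import Data.Fin.Properties using (any?)
open import Data.Fin.Subset using (Subset; _∈_; _∉_; ∣_∣)
open import Data.Fin.Subset.Properties using (_∈?_)
open import Data.Integer.Base as ℤ using (ℤ; +_; 0ℤ; _+_; _-_; _≤_; _<_)
import Data.Integer.Properties as ℤ
open import Data.Nat.Base as ℕ using (ℕ)
import Data.Nat.Properties as ℕ
open import Data.Product.Base using (Σ; ∃; _×_; _,_)
open import Data.Sum.Base using (_⊎_)
open import Data.Vec.Base using (tabulate)
open import Relation.Binary.PropositionalEquality
  using (_≡_; sym; trans; cong; subst; subst₂)
open import Relation.Nullary.Decidable using (Dec; does; map′; ¬?; _×-dec_; _→-dec_)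

Σℤ : ∀ {k} → (Fin k → ℤ) → ℤ
Σℤ = sum ℤ.+-*-semiring

-- The requests for each page are indexed in arbitrary order, and several
-- requests for the same page may arrive at the same time.
record RequestSequence (n : ℕ) : Set where
  field
    count   : Fin n → ℕ
    arrival : (p : Fin n) → Fin (count p) → ℤ

open RequestSequence public

-- σ t is the set of pages broadcast at time t.
Schedule : ℕ → Set
Schedule n = ℤ → Subset n

HasSpeed : ∀ {n} → ℕ → Schedule n → Set
HasSpeed s σ = ∀ t → ∣ σ t ∣ ℕ.≤ s

-- Page p is not broadcast at any time strictly between a and t.
NoBroadcastBetween : ∀ {n} → Schedule n → Fin n → ℤ → ℤ → Set
NoBroadcastBetween σ p a t = ∀ t′ → a < t′ → t′ < t → p ∉ σ t′

-- f is the finish time of a request for p arriving at a: the earliest time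
-- strictly after a at which p is broadcast.
IsFinishTime : ∀ {n} → Schedule n → Fin n → ℤ → ℤ → Set
IsFinishTime σ p a f = a < f × p ∈ σ f × NoBroadcastBetween σ p a f

-- The total flow time is defined only when every request is satisfied; a
-- schedule leaving some request unsatisfied has no (i.e. infinite) flow time.
HasTotalFlowTime : ∀ {n} → RequestSequence n → Schedule n → ℤ → Set
HasTotalFlowTime {n} J σ c =
  Σ ((p : Fin n) → Fin (count J p) → ℤ) λ f →
    (∀ p i → IsFinishTime σ p (arrival J p i) (f p i)) ×
    c ≡ Σℤ (λ p → Σℤ (λ i → f p i - arrival J p i))

IsOPT : ∀ {n} → RequestSequence n → ℤ → Set
IsOPT {n} J c =
  (∃ λ (σ : Schedule n) → HasSpeed 1 σ × HasTotalFlowTime J σ c) ×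
  (∀ (σ : Schedule n) c′ → HasSpeed 1 σ → HasTotalFlowTime J σ c′ → c ≤ c′)

-- Whether a request for p arriving at a belongs to U(t), the set seen by the
-- scheduler at time t. Requests arriving at time t come only after the
-- broadcasts of time t, hence a < t.
Outstanding : ∀ {n} → Schedule n → Fin n → ℤ → ℤ → Set
Outstanding σ p a t = a < t × NoBroadcastBetween σ p a t

private
  a+[t-a]≡t : ∀ a t → a + (t - a) ≡ t
  a+[t-a]≡t a t =
    trans (ℤ.+-comm a (t - a))
    (trans (ℤ.+-assoc t (ℤ.- a) a)
    (trans (cong (λ x → t + x) (ℤ.+-inverseˡ a)) (ℤ.+-identityʳ t)))

  offset : ∀ {a t} → a < t → a + + ℤ.∣ t - a ∣ ≡ t
  offset {a} {t} a<t =
    trans (cong (λ x → a + x) (ℤ.0≤i⇒+∣i∣≡i (ℤ.i≤j⇒0≤j-i (ℤ.<⇒≤ a<t)))) (a+[t-a]≡t a t)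

  offset-< : ∀ {a t d} → a < t → d ℕ.< ℤ.∣ t - a ∣ → a + + d < t
  offset-< {a} {t} {d} a<t d< = subst (a + + d <_) (offset a<t) (ℤ.+-monoʳ-< a (ℤ.+<+ d<))

  offset-<⁻¹ : ∀ {a t t′} → a < t′ → t′ < t → ℤ.∣ t′ - a ∣ ℕ.< ℤ.∣ t - a ∣
  offset-<⁻¹ {a} {t} {t′} a<t′ t′<t =
    ℤ.drop‿+<+ (subst₂ _<_ (eq a<t′) (eq (ℤ.<-trans a<t′ t′<t)) (ℤ.+-monoˡ-< (ℤ.- a) t′<t))
    where
    eq : ∀ {u} → a < u → u - a ≡ + ℤ.∣ u - a ∣
    eq a<u = sym (ℤ.0≤i⇒+∣i∣≡i (ℤ.i≤j⇒0≤j-i (ℤ.<⇒≤ a<u)))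

outstanding? : ∀ {n} (σ : Schedule n) p a t → Dec (Outstanding σ p a t)
outstanding? σ p a t = map′ to from ((a ℤ.<? t) ×-dec ℕ.allUpTo? P? ℤ.∣ t - a ∣)
  where
  P : ℕ → Set
  P d = a < a + + d → p ∉ σ (a + + d)

  P? : ∀ d → Dec (P d)
  P? d = (a ℤ.<? a + + d) →-dec ¬? (p ∈? σ (a + + d))

  to : a < t × (∀ {d} → d ℕ.< ℤ.∣ t - a ∣ → P d) → Outstanding σ p a t
  to (a<t , h) = a<t , λ t′ a<t′ t′<t →
    subst (λ u → a < u → p ∉ σ u) (offset a<t′) (h (offset-<⁻¹ a<t′ t′<t)) a<t′

  from : Outstanding σ p a t → a < t × (∀ {d} → d ℕ.< ℤ.∣ t - a ∣ → P d)
  from (a<t , h) = a<t , λ {d} d< a<a+d → h (a + + d) a<a+d (offset-< a<t d<)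

waitingTime : ∀ {n} → RequestSequence n → Schedule n → ℤ → Fin n → ℤ
waitingTime J σ t p =
  Σℤ (λ i → if does (outstanding? σ p (arrival J p i) t) then t - arrival J p i else 0ℤ)

outstandingPages : ∀ {n} → RequestSequence n → Schedule n → ℤ → Subset n
outstandingPages J σ t =
  tabulate (λ p → does (any? (λ i → outstanding? σ p (arrival J p i) t)))

-- waitingTime and outstandingPages at time t depend only on broadcasts before
-- t, so this is the step-by-step behaviour of the algorithm; every way of
-- breaking ties is allowed.
IsLWF : ∀ {n} → ℕ → RequestSequence n → Schedule n → Set
IsLWF s J σ = ∀ t →
  (s ℕ.≤ ∣ outstandingPages J σ t ∣ × ∣ σ t ∣ ≡ s ×
    (∀ p q → p ∈ σ t → q ∉ σ t → waitingTime J σ t q ≤ waitingTime J σ t p))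
  ⊎
  (∣ outstandingPages J σ t ∣ ℕ.< s × σ t ≡ outstandingPages J σ t)

{-# OPTIONS --safe #-}

-- Let f and g be the finish times of a request under LWF₅ and under a 1-speed
-- schedule. The total flow time of LWF₅ is at most that of the other schedule
-- plus X, the sum of f - g over all requests with g < f. Of these requests, the
-- R_t with g = t are for a single page and have a common f = t + l + 1, and
-- v_t = R_t (l + 1) is their share of X. At each time u = t + k with k ≤ l, this
-- page has waited at least R_t (k + 1) and is not broadcast, so LWF₅ finishes
-- requests of total flow time D_u ≥ 5 R_t (k + 1), and 5 v_t ≤ 2 D_u for u in
-- the upper half of [ t , t + l ]. All the v_t can be charged to such times u so
-- that each u is used at most twice, whence 5 X ≤ 4 Σ_u D_u = 4 LWF₅. Together
-- LWF₅ ≤ 5 OPT.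
module Submission where

open import Defs
import Algebra.Properties.Semiring.Sum
open import Data.Bool.Base using (if_then_else_)
open import Data.Empty using (⊥; ⊥-elim)
open import Data.Fin.Base using (Fin; zero; suc; toℕ)
import Data.Fin.Properties as Fin
open import Data.Fin.Properties using (any?; pigeonhole; toℕ<n)
import Data.Fin.Subset as Subset
open import Data.Fin.Subset using (Subset; inside; outside; _∈_; _∉_; ∣_∣)
open import Data.Fin.Subset.Properties
  using (_∈?_; nonempty?; Empty-unique; ∣⊥∣≡0; x∈p⇒∣p-x∣<∣p∣; x∈p∧x≢y⇒x∈p-y)
import Data.Integer.Base as ℤ
import Data.Integer.Properties as ℤ
open import Data.Integer.Tactic.RingSolver using (solve-∀)
import Data.Nat.Base as ℕ
import Data.Nat.Properties as ℕ
open import Data.Nat.Base using (ℕ; zero; suc)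
open import Data.Product.Base using (∃; _×_; _,_; proj₁; proj₂)
open import Data.Sum.Base using (_⊎_; inj₁; inj₂)
open import Data.Vec.Base using ([]; _∷_; here; there)
open import Data.Vec.Properties using (lookup⇒[]=; lookup∘tabulate)
open import Function.Base using (_∘_)
open import Relation.Binary.Definitions using (tri<; tri≈; tri>)
open import Relation.Binary.PropositionalEquality
  using (_≡_; _≢_; refl; sym; trans; cong; cong₂; subst; subst₂)
open import Relation.Nullary.Decidable using (Dec; yes; no; does; _×-dec_; dec-true)
open import Relation.Nullary.Negation using (¬_; contradiction)

module _ where
  open import Data.Nat.Base using (_+_; _*_; _∸_; _≤_; _<_; z≤n; s≤s; s<s; s<s⁻¹; ⌊_/2⌋; ⌈_/2⌉)
  open ℕ.≤-Reasoning
  open Algebra.Properties.Semiring.Sum ℕ.+-*-semiring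
    using (sum; sum-cong-≗; sum-replicate-zero; ∑-comm; ∑-distrib-+; *-distribˡ-sum)

  -- Finite sums of natural numbers.

  if-≤ : ∀ {P : Set} {x b} (P? : Dec P) → (P → x ≤ b) → (if does P? then x else 0) ≤ b
  if-≤ (yes p) x≤b = x≤b p
  if-≤ (no  _) _   = z≤n

  ≤-if : ∀ {P : Set} {x b} (P? : Dec P) → P → b ≤ x → b ≤ (if does P? then x else 0)
  ≤-if (yes _)  _ b≤x = b≤x
  ≤-if (no  ¬p) p _   = contradiction p ¬p

  sum-mono : ∀ {m} {f g : Fin m → ℕ} → (∀ i → f i ≤ g i) → sum f ≤ sum g
  sum-mono {zero}  f≤g = z≤n
  sum-mono {suc m} f≤g = ℕ.+-mono-≤ (f≤g zero) (sum-mono (f≤g ∘ suc))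

  term≤sum : ∀ {m} (f : Fin m → ℕ) i → f i ≤ sum f
  term≤sum f zero    = ℕ.m≤m+n _ _
  term≤sum f (suc i) = ℕ.≤-trans (term≤sum (f ∘ suc) i) (ℕ.m≤n+m _ (f zero))

  sum-zero : ∀ {m} {f : Fin m → ℕ} → (∀ i → f i ≡ 0) → sum f ≡ 0
  sum-zero {m} f≡0 = trans (sum-cong-≗ f≡0) (sum-replicate-zero m)

  sum-supported : ∀ {m} (f : Fin m → ℕ) i → (∀ j → j ≢ i → f j ≡ 0) → sum f ≡ f i
  sum-supported f zero f≡0 =
    trans (cong (f zero +_) (sum-zero (λ j → f≡0 (suc j) λ ()))) (ℕ.+-identityʳ _)
  sum-supported f (suc i) f≡0 =
    cong₂ _+_ (f≡0 zero λ ()) (sum-supported (f ∘ suc) i (λ j j≢i → f≡0 (suc j) λ { refl → j≢i refl }))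

  ∣S∣*m≤sum : ∀ {k} (S : Subset k) (f : Fin k → ℕ) {m} →
    (∀ {i} → i ∈ S → m ≤ f i) → ∣ S ∣ * m ≤ sum f
  ∣S∣*m≤sum []            f m≤f = z≤n
  ∣S∣*m≤sum (inside  ∷ S) f m≤f = ℕ.+-mono-≤ (m≤f here) (∣S∣*m≤sum S (f ∘ suc) (m≤f ∘ there))
  ∣S∣*m≤sum (outside ∷ S) f m≤f =
    ℕ.≤-trans (∣S∣*m≤sum S (f ∘ suc) (m≤f ∘ there)) (ℕ.m≤n+m _ (f zero))

  Σ< : ℕ → (ℕ → ℕ) → ℕ
  Σ< T f = sum {T} (f ∘ toℕ)

  Σ<-≟ : ∀ T x (f : ℕ → ℕ) → x < T → Σ< T (λ t → if does (x ℕ.≟ t) then f t else 0) ≡ f x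
  Σ<-≟ (suc T) zero    f _   = trans (cong (f 0 +_) (sum-replicate-zero T)) (ℕ.+-identityʳ _)
  Σ<-≟ (suc T) (suc x) f x<T = Σ<-≟ T x (f ∘ suc) (s<s⁻¹ x<T)

  -- Only an inequality, since `x` may lie beyond `T`, where the sum is 0. The prefix bound for
  -- charges needs it at every length.
  Σ<-≟-≤ : ∀ T x (f : ℕ → ℕ) → Σ< T (λ t → if does (x ℕ.≟ t) then f t else 0) ≤ f x
  Σ<-≟-≤ zero    _       f = z≤n
  Σ<-≟-≤ (suc T) zero    f = ℕ.≤-reflexive (Σ<-≟ (suc T) zero f (s≤s z≤n))
  Σ<-≟-≤ (suc T) (suc x) f = Σ<-≟-≤ T x (f ∘ suc)

  Σ<-drop : ∀ h m (f : ℕ → ℕ) → Σ< m (f ∘ (h +_)) ≤ Σ< (h + m) f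
  Σ<-drop zero    m f = ℕ.≤-refl
  Σ<-drop (suc h) m f = ℕ.≤-trans (Σ<-drop h m (f ∘ suc)) (ℕ.m≤n+m _ (f 0))

  -- Averaging: `m` values that are all at least 2 would add up to at least `m * 2`.
  value<2 : ∀ m (f : ℕ → ℕ) → Σ< m f < m * 2 → ∃ λ j → j < m × f j < 2
  value<2 (suc m) f Σ<2m with f 0 ℕ.<? 2
  ... | yes f0<2 = 0 , s≤s z≤n , f0<2
  ... | no  f0≮2 with value<2 m (f ∘ suc)
        (ℕ.+-cancelˡ-< 2 _ _ (ℕ.≤-<-trans (ℕ.+-monoˡ-≤ _ (ℕ.≮⇒≥ f0≮2)) Σ<2m))
  ...   | j , j<m , fj<2 = suc j , s<s j<m , fj<2

  -- Charging times to slots, at most two charges per slot.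

  -- A time t with v t ≢ 0 owns the interval [ t , t + l ], and N dominates v t
  -- on the upper half of that interval.
  Dominated : ℕ → (v N : ℕ → ℕ) → ℕ → Set
  Dominated T v N t = v t ≡ 0 ⊎
    ∃ λ l → t + l < T × (∀ k → k ≤ l → suc l ≤ suc k * 2 → v t ≤ N (t + k))

  -- Going through the times t from right to left, charge v t to a slot of the
  -- upper half of [ t , t + l ] that has been used at most once so far. There
  -- is one, since only the l times in ( t , t + l ] can have used those slots,
  -- and the upper half has more than l / 2 of them.
  assignment : ∀ T (v N : ℕ → ℕ) → (∀ t → Dominated T v N t) →
    ∃ λ (c : ℕ → ℕ) → (∀ u → c u ≤ 2) × (∀ B → Σ< B c ≤ B) ×
      Σ< T v ≤ Σ< T (λ u → c u * N u)
  assignment zero    v N dom = (λ _ → 0) , (λ _ → z≤n) , (λ B → subst (_≤ B) (sym (sum-replicate-zero B)) z≤n) , z≤n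
  assignment (suc T) v N dom = step (assignment T (v ∘ suc) (N ∘ suc) (shift ∘ dom ∘ suc)) (dom 0)
    where
    shift : ∀ {t} → Dominated (suc T) v N (suc t) → Dominated T (v ∘ suc) (N ∘ suc) t
    shift (inj₁ v≡0)               = inj₁ v≡0
    shift (inj₂ (l , t+l<T , v≤N)) = inj₂ (l , s<s⁻¹ t+l<T , v≤N)

    step : (∃ λ (c : ℕ → ℕ) → (∀ u → c u ≤ 2) × (∀ B → Σ< B c ≤ B) ×
             Σ< T (v ∘ suc) ≤ Σ< T (λ u → c u * N (suc u))) →
           Dominated (suc T) v N 0 →
           ∃ λ (c : ℕ → ℕ) → (∀ u → c u ≤ 2) × (∀ B → Σ< B c ≤ B) ×
             Σ< (suc T) v ≤ Σ< (suc T) (λ u → c u * N u)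
    step (c , c≤2 , Σc≤ , Σv≤) = case
      where
      c₀ : ℕ → ℕ
      c₀ zero    = 0
      c₀ (suc u) = c u

      c₀≤2 : ∀ u → c₀ u ≤ 2
      c₀≤2 zero    = z≤n
      c₀≤2 (suc u) = c≤2 u

      -- Prepending the empty slot 0 gives every nonempty prefix one unit of slack. The new charge
      -- made for time 0 uses it up in `Σc₁≤`.
      Σc₀≤ : ∀ B → Σ< (suc B) c₀ ≤ B
      Σc₀≤ = Σc≤

      case : Dominated (suc T) v N 0 → _
      case (inj₁ v≡0) = c₀ , c₀≤2 , bound , ℕ.≤-trans (ℕ.≤-reflexive (cong (_+ Σ< T (v ∘ suc)) v≡0)) Σv≤
        where
        bound : ∀ B → Σ< B c₀ ≤ B
        bound zero    = z≤n
        bound (suc B) = ℕ.≤-trans (Σc₀≤ B) (ℕ.n≤1+n B)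
      case (inj₂ (l , l<T , v≤N)) = add (value<2 (suc ⌈ l /2⌉) (c₀ ∘ (h +_)) room)
        where
        -- This is the least `k` with `suc l ≤ suc k * 2`, so the slots from `h` to `l` are exactly
        -- the upper half.
        h = ⌊ l /2⌋

        h+m≡1+l : h + suc ⌈ l /2⌉ ≡ suc l
        h+m≡1+l = trans (ℕ.+-suc h _) (cong suc (ℕ.⌊n/2⌋+⌈n/2⌉≡n l))

        room : Σ< (suc ⌈ l /2⌉) (c₀ ∘ (h +_)) < suc ⌈ l /2⌉ * 2
        room = begin-strict
          Σ< (suc ⌈ l /2⌉) (c₀ ∘ (h +_))  ≤⟨ Σ<-drop h _ c₀ ⟩
          Σ< (h + suc ⌈ l /2⌉) c₀         ≡⟨ cong (λ m → Σ< m c₀) h+m≡1+l ⟩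
          Σ< (suc l) c₀                   ≤⟨ Σc₀≤ l ⟩
          l                               ≡⟨ ℕ.⌊n/2⌋+⌈n/2⌉≡n l ⟨
          ⌊ l /2⌋ + ⌈ l /2⌉               ≤⟨ ℕ.+-monoˡ-≤ _ (ℕ.⌊n/2⌋≤⌈n/2⌉ l) ⟩
          ⌈ l /2⌉ + ⌈ l /2⌉               ≡⟨ cong (⌈ l /2⌉ +_) (ℕ.+-identityʳ _) ⟨
          2 * ⌈ l /2⌉                     ≡⟨ ℕ.*-comm 2 ⌈ l /2⌉ ⟩
          ⌈ l /2⌉ * 2                     <⟨ ℕ.n<1+n _ ⟩
          1 + ⌈ l /2⌉ * 2                 <⟨ ℕ.n<1+n _ ⟩
          suc ⌈ l /2⌉ * 2                 ∎

        add : (∃ λ j → j < suc ⌈ l /2⌉ × c₀ (h + j) < 2) → _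
        add (j , j<m , ck<2) = c₁ , c₁≤2 , Σc₁≤ , total
          where
          k = h + j

          k≤l : k ≤ l
          k≤l = ℕ.s≤s⁻¹ (ℕ.≤-trans (ℕ.+-monoʳ-< h j<m) (ℕ.≤-reflexive h+m≡1+l))

          l<2+2k : suc l ≤ suc k * 2
          l<2+2k = begin
            suc l                      ≡⟨ cong suc (ℕ.⌊n/2⌋+⌈n/2⌉≡n l) ⟨
            -- `⌈ l /2⌉` unfolds to `⌊ suc l /2⌋`, which is at most `⌊ suc (suc l) /2⌋`, that is
            -- `suc h`.
            suc (h + ⌈ l /2⌉)          ≤⟨ s≤s (ℕ.+-monoʳ-≤ h (ℕ.⌊n/2⌋-mono (ℕ.n≤1+n (suc l)))) ⟩
            suc (h + suc h)            ≡⟨ cong suc (ℕ.+-suc h h) ⟩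
            2 + (h + h)                ≡⟨ cong (λ x → 2 + (h + x)) (ℕ.+-identityʳ h) ⟨
            2 + 2 * h                  ≡⟨ cong (2 +_) (ℕ.*-comm 2 h) ⟩
            2 + h * 2                  ≤⟨ ℕ.+-monoʳ-≤ 2 (ℕ.*-monoˡ-≤ 2 (ℕ.m≤m+n h j)) ⟩
            suc k * 2                  ∎

          δ : (ℕ → ℕ) → ℕ → ℕ
          δ f u = if does (k ℕ.≟ u) then f u else 0

          c₁ : ℕ → ℕ
          c₁ u = δ (λ _ → 1) u + c₀ u

          c₁≤2 : ∀ u → c₁ u ≤ 2
          c₁≤2 u = bound (k ℕ.≟ u)
            where
            bound : (k≟u : Dec (k ≡ u)) → (if does k≟u then 1 else 0) + c₀ u ≤ 2
            bound (yes refl) = ck<2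
            bound (no _)     = c₀≤2 u

          Σc₁≤ : ∀ B → Σ< B c₁ ≤ B
          Σc₁≤ zero    = z≤n
          Σc₁≤ (suc B) = begin
            Σ< (suc B) c₁                               ≡⟨ ∑-distrib-+ (δ (λ _ → 1) ∘ toℕ {suc B}) (c₀ ∘ toℕ) ⟩
            Σ< (suc B) (δ (λ _ → 1)) + Σ< (suc B) c₀    ≤⟨ ℕ.+-mono-≤ (Σ<-≟-≤ (suc B) k (λ _ → 1)) (Σc₀≤ B) ⟩
            suc B                                       ∎

          δ-* : ∀ u → δ N u + c₀ u * N u ≡ c₁ u * N u
          δ-* u = eq (k ℕ.≟ u)
            where
            eq : (k≟u : Dec (k ≡ u)) → (if does k≟u then N u else 0) + c₀ u * N u
                 ≡ ((if does k≟u then 1 else 0) + c₀ u) * N u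
            eq (yes _) = refl
            eq (no _)  = refl

          total : Σ< (suc T) v ≤ Σ< (suc T) (λ u → c₁ u * N u)
          total = begin
            v 0 + Σ< T (v ∘ suc)                                 ≤⟨ ℕ.+-mono-≤ (v≤N k k≤l l<2+2k) Σv≤ ⟩
            N k + Σ< (suc T) (λ u → c₀ u * N u)                  ≡⟨ cong (_+ Σ< (suc T) (λ u → c₀ u * N u)) (Σ<-≟ (suc T) k N (ℕ.≤-<-trans k≤l l<T)) ⟨
            Σ< (suc T) (δ N) + Σ< (suc T) (λ u → c₀ u * N u)     ≡⟨ ∑-distrib-+ (δ N ∘ toℕ {suc T}) (λ u → c₀ (toℕ u) * N (toℕ u)) ⟨
            Σ< (suc T) (λ u → δ N u + c₀ u * N u)                ≡⟨ sum-cong-≗ (δ-* ∘ toℕ {suc T}) ⟩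
            Σ< (suc T) (λ u → c₁ u * N u)                        ∎

  -- The factor 2 is the number of charges that a slot may carry.
  Σ<-dominated : ∀ T (v N : ℕ → ℕ) → (∀ t → Dominated T v N t) → Σ< T v ≤ 2 * Σ< T N
  Σ<-dominated T v N dom with assignment T v N dom
  ... | c , c≤2 , _ , Σv≤ = begin
    Σ< T v                    ≤⟨ Σv≤ ⟩
    Σ< T (λ u → c u * N u)    ≤⟨ sum-mono {T} (λ u → ℕ.*-monoˡ-≤ (N (toℕ u)) (c≤2 (toℕ u))) ⟩
    Σ< T (λ u → 2 * N u)      ≡⟨ *-distribˡ-sum 2 (N ∘ toℕ {T}) ⟨
    2 * Σ< T N                ∎

  -- Sums over all requests of all pages.

  Σ₂ : ∀ {n} {cnt : Fin n → ℕ} → (∀ p → Fin (cnt p) → ℕ) → ℕ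
  Σ₂ f = sum (λ p → sum (f p))

  Σ₂-mono : ∀ {n} {cnt : Fin n → ℕ} {f g : ∀ p → Fin (cnt p) → ℕ} →
    (∀ p i → f p i ≤ g p i) → Σ₂ f ≤ Σ₂ g
  Σ₂-mono f≤g = sum-mono (λ p → sum-mono (f≤g p))

  Σ₂-zero : ∀ {n} {cnt : Fin n → ℕ} {f : ∀ p → Fin (cnt p) → ℕ} →
    (∀ p i → f p i ≡ 0) → Σ₂ f ≡ 0
  Σ₂-zero f≡0 = sum-zero (λ p → sum-zero (f≡0 p))

  Σ₂-distrib-+ : ∀ {n} {cnt : Fin n → ℕ} (f g : ∀ p → Fin (cnt p) → ℕ) →
    Σ₂ (λ p i → f p i + g p i) ≡ Σ₂ f + Σ₂ g
  Σ₂-distrib-+ f g = trans (sum-cong-≗ (λ p → ∑-distrib-+ (f p) (g p)))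
    (∑-distrib-+ (λ p → sum (f p)) (λ p → sum (g p)))

  term≤Σ₂ : ∀ {n} {cnt : Fin n → ℕ} (f : ∀ p → Fin (cnt p) → ℕ) p i → f p i ≤ Σ₂ f
  term≤Σ₂ f p i = ℕ.≤-trans (term≤sum (f p) i) (term≤sum (λ p → sum (f p)) p)

  -- Double counting: after exchanging the sums, each request contributes at the single time
  -- `x p i`. This regroups the excess by `γ` and the flow time by `φ`.
  Σ<-Σ₂ : ∀ {n} {cnt : Fin n → ℕ} T (x f : ∀ p → Fin (cnt p) → ℕ) → (∀ p i → x p i < T) →
    Σ< T (λ t → Σ₂ (λ p i → if does (x p i ℕ.≟ t) then f p i else 0)) ≡ Σ₂ f
  Σ<-Σ₂ T x f x<T = trans (∑-comm (λ t p → sum (λ i → at p i (toℕ {T} t)))) (sum-cong-≗ λ p →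
    trans (∑-comm (λ t i → at p i (toℕ {T} t))) (sum-cong-≗ λ i → Σ<-≟ T (x p i) (λ _ → f p i) (x<T p i)))
    where
    at = λ p i t → if does (x p i ℕ.≟ t) then f p i else 0

  -- Comparison of the two families of finish times.

  -- α, φ and γ are the arrival times and the finish times under LWF₅ and under
  -- the 1-speed schedule.
  module Charging {n} {cnt : Fin n → ℕ} (α φ γ : ∀ p → Fin (cnt p) → ℕ)
    (α<γ : ∀ p i → α p i < γ p i)
    (same-page : ∀ {p q i j} → γ p i ≡ γ q j → p ≡ q)
    (same-finish : ∀ {p i j} → γ p i ≡ γ p j → γ p i < φ p i → γ p j < φ p j → φ p i ≡ φ p j)
    (longest-first : ∀ {p i u} → α p i < u → u < φ p i →
      5 * sum (λ j → if does (u ℕ.≤? φ p j) then u ∸ α p j else 0) ≤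
      Σ₂ (λ q j → if does (φ q j ℕ.≟ u) then φ q j ∸ α q j else 0))
    where

    T : ℕ
    T = suc (Σ₂ φ + Σ₂ γ)

    φ<T : ∀ p i → φ p i < T
    φ<T p i = s≤s (ℕ.≤-trans (term≤Σ₂ φ p i) (ℕ.m≤m+n _ _))

    γ<T : ∀ p i → γ p i < T
    γ<T p i = s≤s (ℕ.≤-trans (term≤Σ₂ γ p i) (ℕ.m≤n+m _ (Σ₂ φ)))

    -- Truncated subtraction gives 0 when LWF₅ finishes the request no later than the other
    -- schedule, so `Σ₂ excess` is the quantity X.
    excess : ∀ p → Fin (cnt p) → ℕ
    excess p i = φ p i ∸ γ p i

    excessAt : ℕ → ℕ
    excessAt t = Σ₂ (λ p i → if does (γ p i ℕ.≟ t) then excess p i else 0)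

    -- A request that finishes at `u` itself still counts, and one that arrives at `u` or later
    -- contributes 0 by truncated subtraction.
    waitingAt : Fin n → ℕ → ℕ
    waitingAt p u = sum (λ j → if does (u ℕ.≤? φ p j) then u ∸ α p j else 0)

    finishedAt : ℕ → ℕ
    finishedAt u = Σ₂ (λ q j → if does (φ q j ℕ.≟ u) then φ q j ∸ α q j else 0)

    Late : ℕ → Set
    Late t = ∃ λ p → ∃ λ i → γ p i ≡ t × t < φ p i

    late? : ∀ t → Dec (Late t)
    late? t = any? λ p → any? λ i → (γ p i ℕ.≟ t) ×-dec (t ℕ.<? φ p i)

    -- This is 5 v_t ≤ 2 D_u, with both factors kept to avoid fractions. If no request is late at
    -- `t`, then v_t is 0. Otherwise any late request supplies the page and the common finish time.
    dominated : ∀ t → Dominated T (λ t → 5 * excessAt t) (λ u → 2 * finishedAt u) t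
    dominated t with late? t
    ... | no ¬late = inj₁ (cong (5 *_) (Σ₂-zero λ p i → ℕ.n≤0⇒n≡0 (if-≤ (γ p i ℕ.≟ t) λ γ≡t →
            ℕ.≤-reflexive (ℕ.m≤n⇒m∸n≡0 (subst (φ p i ≤_) (sym γ≡t)
              (ℕ.≮⇒≥ λ t<φ → ¬late (p , i , γ≡t , t<φ)))))))
    ... | yes (p , i , refl , t<φ) = inj₂ (l , t+l<T , bound)
      where
      -- Chosen so that `t + l` is the last time before the finish time `φ p i`.
      l = φ p i ∸ suc t

      1+t+l≡φ : suc t + l ≡ φ p i
      1+t+l≡φ = ℕ.m+[n∸m]≡n t<φ

      t+l<T : t + l < T
      t+l<T = ℕ.≤-trans (ℕ.≤-reflexive 1+t+l≡φ) (ℕ.<⇒≤ (φ<T p i))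

      φ∸t≡1+l : φ p i ∸ t ≡ suc l
      φ∸t≡1+l = trans (cong (_∸ t) (sym (trans (ℕ.+-suc t l) 1+t+l≡φ))) (ℕ.m+n∸m≡n t (suc l))

      bound : ∀ k → k ≤ l → suc l ≤ suc k * 2 → 5 * excessAt t ≤ 2 * finishedAt (t + k)
      bound k k≤l l<2+2k = begin
        5 * excessAt t                   ≡⟨ cong (5 *_) (sum-supported _ p other-page) ⟩
        5 * sum (λ j → if does (γ p j ℕ.≟ t) then excess p j else 0)
                                         ≤⟨ ℕ.*-monoʳ-≤ 5 (sum-mono (λ j → if-≤ (γ p j ℕ.≟ t) (term j))) ⟩
        5 * sum (λ j → 2 * waiting j)    ≡⟨ cong (5 *_) (*-distribˡ-sum 2 waiting) ⟨
        5 * (2 * waitingAt p u)          ≡⟨ ℕ.*-assoc 5 2 (waitingAt p u) ⟨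
        2 * 5 * waitingAt p u            ≡⟨ ℕ.*-assoc 2 5 (waitingAt p u) ⟩
        2 * (5 * waitingAt p u)          ≤⟨ ℕ.*-monoʳ-≤ 2 (longest-first α<u u<φ) ⟩
        2 * finishedAt u                 ∎
        where
        u = t + k

        α<u : α p i < u
        α<u = ℕ.<-≤-trans (α<γ p i) (ℕ.m≤m+n t k)

        u<φ : u < φ p i
        u<φ = ℕ.≤-trans (s≤s (ℕ.+-monoʳ-≤ t k≤l)) (ℕ.≤-reflexive 1+t+l≡φ)

        waiting : Fin (cnt p) → ℕ
        waiting j = if does (u ℕ.≤? φ p j) then u ∸ α p j else 0

        other-page : ∀ q → q ≢ p → sum (λ j → if does (γ q j ℕ.≟ t) then excess q j else 0) ≡ 0
        other-page q q≢p = sum-zero λ j → ℕ.n≤0⇒n≡0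
          (if-≤ (γ q j ℕ.≟ t) λ γ≡t → contradiction (same-page γ≡t) q≢p)

        term : ∀ j → γ p j ≡ t → excess p j ≤ 2 * waiting j
        term j γ≡t with t ℕ.<? φ p j
        ... | no  t≮φ = ℕ.≤-trans (ℕ.≤-reflexive (ℕ.m≤n⇒m∸n≡0 (subst (φ p j ≤_) (sym γ≡t) (ℕ.≮⇒≥ t≮φ)))) z≤n
        ... | yes t<φⱼ = begin
          φ p j ∸ γ p j    ≡⟨ cong₂ _∸_ φⱼ≡φ γ≡t ⟩
          φ p i ∸ t        ≡⟨ φ∸t≡1+l ⟩
          suc l            ≤⟨ l<2+2k ⟩
          suc k * 2        ≡⟨ ℕ.*-comm (suc k) 2 ⟩
          -- The request arrived strictly before `t`, so at `u = t + k` it has waited at least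
          -- `k + 1`.
          2 * suc k        ≤⟨ ℕ.*-monoʳ-≤ 2 (≤-if (u ℕ.≤? φ p j) u≤φⱼ (ℕ.m+n≤o⇒m≤o∸n (suc k) k+α<u)) ⟩
          2 * waiting j    ∎
          where
          φⱼ≡φ : φ p j ≡ φ p i
          φⱼ≡φ = same-finish γ≡t (subst (_< φ p j) (sym γ≡t) t<φⱼ) t<φ

          u≤φⱼ : u ≤ φ p j
          u≤φⱼ = subst (u ≤_) (sym φⱼ≡φ) (ℕ.<⇒≤ u<φ)

          k+α<u : suc k + α p j ≤ u
          k+α<u = begin
            suc k + α p j      ≡⟨ ℕ.+-suc k (α p j) ⟨
            k + suc (α p j)    ≤⟨ ℕ.+-monoʳ-≤ k (subst (α p j <_) γ≡t (α<γ p j)) ⟩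
            k + t              ≡⟨ ℕ.+-comm k t ⟩
            u                  ∎

    flowφ flowγ : ∀ p → Fin (cnt p) → ℕ
    flowφ p i = φ p i ∸ α p i
    flowγ p i = γ p i ∸ α p i

    -- One factor 2 counts the charges per slot, the other comes from waits that are only half of
    -- the excess. Each request finishes at exactly one time, so the D_u add up to the total flow
    -- time.
    5*excess≤4*flow : 5 * Σ₂ excess ≤ 4 * Σ₂ flowφ
    5*excess≤4*flow = begin
      5 * Σ₂ excess                       ≡⟨ cong (5 *_) (Σ<-Σ₂ T γ excess γ<T) ⟨
      5 * Σ< T excessAt                   ≡⟨ *-distribˡ-sum 5 (excessAt ∘ toℕ {T}) ⟩
      Σ< T (λ t → 5 * excessAt t)         ≤⟨ Σ<-dominated T (λ t → 5 * excessAt t) (λ u → 2 * finishedAt u) dominated ⟩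
      2 * Σ< T (λ u → 2 * finishedAt u)   ≡⟨ cong (2 *_) (*-distribˡ-sum 2 (finishedAt ∘ toℕ {T})) ⟨
      2 * (2 * Σ< T finishedAt)           ≡⟨ ℕ.*-assoc 2 2 (Σ< T finishedAt) ⟨
      4 * Σ< T finishedAt                 ≡⟨ cong (4 *_) (Σ<-Σ₂ T φ flowφ φ<T) ⟩
      4 * Σ₂ flowφ                        ∎

    flowφ≤flowγ+excess : ∀ p i → flowφ p i ≤ flowγ p i + excess p i
    flowφ≤flowγ+excess p i = ℕ.m≤n+o⇒m∸n≤o (φ p i) (α p i) (begin
      φ p i                                ≤⟨ ℕ.m≤n+m∸n (φ p i) (γ p i) ⟩
      γ p i + excess p i                   ≡⟨ cong (_+ excess p i) (ℕ.m+[n∸m]≡n (ℕ.<⇒≤ (α<γ p i))) ⟨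
      α p i + flowγ p i + excess p i       ≡⟨ ℕ.+-assoc (α p i) (flowγ p i) (excess p i) ⟩
      α p i + (flowγ p i + excess p i)     ∎)

    -- The excess costs only 4 of the 5 copies of the flow time on the left, so cancelling leaves
    -- one copy.
    flowφ≤5*flowγ : Σ₂ flowφ ≤ 5 * Σ₂ flowγ
    flowφ≤5*flowγ = ℕ.+-cancelʳ-≤ (4 * Σ₂ flowφ) _ _ (begin
      5 * Σ₂ flowφ                                 ≤⟨ ℕ.*-monoʳ-≤ 5 (Σ₂-mono flowφ≤flowγ+excess) ⟩
      5 * Σ₂ (λ p i → flowγ p i + excess p i)      ≡⟨ cong (5 *_) (Σ₂-distrib-+ flowγ excess) ⟩
      5 * (Σ₂ flowγ + Σ₂ excess)                   ≡⟨ ℕ.*-distribˡ-+ 5 (Σ₂ flowγ) (Σ₂ excess) ⟩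
      5 * Σ₂ flowγ + 5 * Σ₂ excess                 ≤⟨ ℕ.+-monoʳ-≤ (5 * Σ₂ flowγ) 5*excess≤4*flow ⟩
      5 * Σ₂ flowγ + 4 * Σ₂ flowφ                  ∎)

module _ where
  open import Data.Integer.Base using (ℤ; +_; _-_; -_; +<+; +≤+)
  open Algebra.Properties.Semiring.Sum ℕ.+-*-semiring using (sum)

  -- Facts on integer sums, subsets and finish times.

  Σℤ-+ : ∀ {k} {x : Fin k → ℤ} {y : Fin k → ℕ} → (∀ i → x i ≡ + y i) → Σℤ x ≡ + sum y
  Σℤ-+ {zero}  x≡y = refl
  Σℤ-+ {suc k} x≡y = cong₂ ℤ._+_ (x≡y zero) (Σℤ-+ (x≡y ∘ suc))

  least : ∀ {P : ℕ → Set} → (∀ k → Dec (P k)) → ∀ b → (∃ λ k → k ℕ.< b × P k) →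
    ∃ λ m → P m × (∀ k → k ℕ.< m → ¬ P k)
  least P? (suc b) (k , k<1+b , Pk) with ℕ.anyUpTo? P? b
  ... | yes below = least P? b below
  ... | no  ¬below = k , Pk , λ j j<k Pj → ¬below (j , ℕ.<-≤-trans j<k (ℕ.s≤s⁻¹ k<1+b) , Pj)

  ∣S∣≤1⇒unique : ∀ {k} {S : Subset k} {i j} → ∣ S ∣ ℕ.≤ 1 → i ∈ S → j ∈ S → i ≡ j
  ∣S∣≤1⇒unique {S = S} {i} {j} ∣S∣≤1 i∈S j∈S with i Fin.≟ j
  ... | yes i≡j = i≡j
  ... | no  i≢j = contradiction
    (ℕ.≤-<-trans 1≤∣S-i∣ (ℕ.<-≤-trans (x∈p⇒∣p-x∣<∣p∣ i∈S) ∣S∣≤1)) (ℕ.<-irrefl refl)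
    where
    1≤∣S-i∣ : 1 ℕ.≤ ∣ S Subset.- i ∣
    1≤∣S-i∣ = ℕ.≤-<-trans ℕ.z≤n (x∈p⇒∣p-x∣<∣p∣ (x∈p∧x≢y⇒x∈p-y j∈S (i≢j ∘ sym)))

  0<∣S∣⇒nonempty : ∀ {k} (S : Subset k) → 0 ℕ.< ∣ S ∣ → ∃ (_∈ S)
  0<∣S∣⇒nonempty {k} S 0<∣S∣ with nonempty? S
  ... | yes S≢∅ = S≢∅
  ... | no  S≡∅ = contradiction (subst (0 ℕ.<_) (trans (cong ∣_∣ (Empty-unique S≡∅)) (∣⊥∣≡0 k)) 0<∣S∣) ℕ.n≮0

  -- If the finish times differed, the earlier one would be a broadcast of `p` while the other
  -- request is still waiting.
  finish-shared : ∀ {n} {σ : Schedule n} {p a b f g} → IsFinishTime σ p a f → IsFinishTime σ p b g →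
    a ℤ.< g → b ℤ.< f → f ≡ g
  finish-shared {f = f} {g} (_ , p∈σf , none<f) (_ , p∈σg , none<g) a<g b<f with ℤ.<-cmp f g
  ... | tri< f<g _ _ = contradiction p∈σf (none<g f b<f f<g)
  ... | tri≈ _ f≡g _ = f≡g
  ... | tri> _ _ g<f = contradiction p∈σg (none<f g a<g g<f)

  -- Natural-number coordinates for time.

  module _ {n} (J : RequestSequence n) where

    -- An origin no later than any arrival, so that all relevant times are `at u` for a natural
    -- number `u`.
    T₀ : ℤ
    T₀ = - + Σ₂ (λ p i → ℤ.∣ arrival J p i ∣)

    at : ℕ → ℤ
    at u = T₀ ℤ.+ + u

    at-mono-< : ∀ {u v} → u ℕ.< v → at u ℤ.< at v
    at-mono-< u<v = ℤ.+-monoʳ-< T₀ (+<+ u<v)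

    at-injective : ∀ {u v} → at u ≡ at v → u ≡ v
    at-injective {u} {v} eq with ℕ.<-cmp u v
    ... | tri< u<v _ _ = contradiction eq (ℤ.<⇒≢ (at-mono-< u<v))
    ... | tri≈ _ u≡v _ = u≡v
    ... | tri> _ _ v<u = contradiction (sym eq) (ℤ.<⇒≢ (at-mono-< v<u))

    at-cancel-< : ∀ {u v} → at u ℤ.< at v → u ℕ.< v
    at-cancel-< {u} {v} u<v with ℕ.<-cmp u v
    ... | tri< lt _ _ = lt
    ... | tri≈ _ refl _ = contradiction u<v (ℤ.<-irrefl refl)
    ... | tri> _ _ gt = contradiction u<v (ℤ.<-asym (at-mono-< gt))

    at-surjective : ∀ {t} → T₀ ℤ.≤ t → ∃ λ u → t ≡ at u
    at-surjective {t} T₀≤t = ℤ.∣ t - T₀ ∣ ,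
      trans (decompose t T₀) (cong (λ x → T₀ ℤ.+ x) (sym (ℤ.0≤i⇒+∣i∣≡i (ℤ.i≤j⇒0≤j-i T₀≤t))))
      where
      decompose : ∀ s t → s ≡ t ℤ.+ (s - t)
      decompose = solve-∀

    at-∸ : ∀ {u v} → u ℕ.≤ v → at v - at u ≡ + (v ℕ.∸ u)
    at-∸ {u} {v} u≤v = trans (difference T₀ (+ u) (+ v)) (trans (ℤ.m-n≡m⊖n v u) (ℤ.⊖-≥ u≤v))
      where
      difference : ∀ t x y → (t ℤ.+ y) - (t ℤ.+ x) ≡ y - x
      difference = solve-∀

    T₀≤arrival : ∀ p i → T₀ ℤ.≤ arrival J p i
    T₀≤arrival p i = ℤ.≤-trans (ℤ.neg-mono-≤ (+≤+ (term≤Σ₂ (λ p i → ℤ.∣ arrival J p i ∣) p i)))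
      (-∣a∣≤a (arrival J p i))
      where
      -∣a∣≤a : ∀ a → - + ℤ.∣ a ∣ ℤ.≤ a
      -∣a∣≤a (+ zero)     = ℤ.≤-refl
      -∣a∣≤a ℤ.+[1+ _ ]   = ℤ.-≤+
      -∣a∣≤a ℤ.-[1+ _ ]   = ℤ.≤-refl

    α : ∀ p → Fin (count J p) → ℕ
    α p i = at-surjective (T₀≤arrival p i) .proj₁

    arrival≡ : ∀ p i → arrival J p i ≡ at (α p i)
    arrival≡ p i = at-surjective (T₀≤arrival p i) .proj₂

    arrival< : ∀ {p i u} → α p i ℕ.< u → arrival J p i ℤ.< at u
    arrival< {p} {i} α<u = subst (ℤ._< _) (sym (arrival≡ p i)) (at-mono-< α<u)

    arrival<⁻¹ : ∀ {p i u} → arrival J p i ℤ.< at u → α p i ℕ.< u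
    arrival<⁻¹ {p} {i} a<u = at-cancel-< (subst (ℤ._< _) (arrival≡ p i) a<u)

    wait≡ : ∀ {p i u} → α p i ℕ.≤ u → at u - arrival J p i ≡ + (u ℕ.∸ α p i)
    wait≡ {p} {i} {u} α≤u = trans (cong (λ a → at u - a) (arrival≡ p i)) (at-∸ α≤u)

    after-arrival : ∀ {p i t} → arrival J p i ℤ.< t → ∃ λ u → t ≡ at u
    after-arrival {p} {i} a<t = at-surjective (ℤ.≤-trans (T₀≤arrival p i) (ℤ.<⇒≤ a<t))

    flow≡ : ∀ {σ} (f : ∀ p → Fin (count J p) → ℕ) → (∀ p i → IsFinishTime σ p (arrival J p i) (at (f p i))) →
      Σℤ (λ p → Σℤ (λ i → at (f p i) - arrival J p i)) ≡ + Σ₂ (λ p i → f p i ℕ.∸ α p i)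
    flow≡ f finish = Σℤ-+ λ p → Σℤ-+ λ i → wait≡ (ℕ.<⇒≤ (arrival<⁻¹ (finish p i .proj₁)))

    -- Waiting times and the longest-wait-first rule.

    module _ (σ : Schedule n) where

      outstandingAt? : ∀ p i u → Dec (Outstanding σ p (arrival J p i) (at u))
      outstandingAt? p i u = outstanding? σ p (arrival J p i) (at u)

      waiting : ℕ → Fin n → ℕ
      waiting u p = sum (λ i → if does (outstandingAt? p i u) then u ℕ.∸ α p i else 0)

      waitingTime≡ : ∀ u p → waitingTime J σ (at u) p ≡ + waiting u p
      waitingTime≡ u p = Σℤ-+ λ i → term i (outstandingAt? p i u)
        where
        term : ∀ i (out? : Dec (Outstanding σ p (arrival J p i) (at u))) →
          (if does out? then at u - arrival J p i else ℤ.0ℤ) ≡ + (if does out? then u ℕ.∸ α p i else 0)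
        term i (yes (a<u , _)) = wait≡ (ℕ.<⇒≤ (arrival<⁻¹ a<u))
        term i (no _)          = refl

      outstanding⇒waiting>0 : ∀ {p i u} → Outstanding σ p (arrival J p i) (at u) → 0 ℕ.< waiting u p
      outstanding⇒waiting>0 {p} {i} {u} out = ℕ.≤-trans
        (≤-if (outstandingAt? p i u) out (ℕ.m<n⇒0<n∸m (arrival<⁻¹ (out .proj₁))))
        (term≤sum (λ i → if does (outstandingAt? p i u) then u ℕ.∸ α p i else 0) i)

      waiting>0⇒outstanding : ∀ {p u} → 0 ℕ.< waiting u p → ∃ λ i → Outstanding σ p (arrival J p i) (at u)
      waiting>0⇒outstanding {p} {u} w>0 with any? (λ i → outstandingAt? p i u)
      ... | yes out = out
      ... | no ¬out = contradiction w>0 (ℕ.≤⇒≯ (ℕ.≤-reflexive (sum-zero λ i → ℕ.n≤0⇒n≡0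
              (if-≤ (outstandingAt? p i u) λ out → contradiction (i , out) ¬out))))

      module _ (lwf : IsLWF 5 J σ) where

        -- An outstanding page can be passed over only in the first case of `IsLWF`, since the
        -- second broadcasts all outstanding pages.
        skipped : ∀ {p i u} → Outstanding σ p (arrival J p i) (at u) → p ∉ σ (at u) →
          ∣ σ (at u) ∣ ≡ 5 × (∀ q → q ∈ σ (at u) → waiting u p ℕ.≤ waiting u q)
        skipped {p} {i} {u} out p∉σ with lwf (at u)
        ... | inj₁ (_ , ∣σ∣≡5 , longest) = ∣σ∣≡5 , λ q q∈σ → ℤ.drop‿+≤+
                (subst₂ ℤ._≤_ (waitingTime≡ u p) (waitingTime≡ u q) (longest q p q∈σ p∉σ))
        ... | inj₂ (_ , σ≡out) = contradiction
                (subst (p ∈_) (sym σ≡out) (lookup⇒[]= p _ (trans (lookup∘tabulate _ p)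
                  (dec-true (any? (λ i → outstandingAt? p i u)) (i , out)))))
                p∉σ

        -- LWF₅ satisfies every request.

        K : ℕ
        K = Σ₂ α

        -- Consecutive times after all arrivals, one more of them than there are pages.
        τ : Fin (suc n) → ℕ
        τ k = suc (K ℕ.+ toℕ k)

        α<τ : ∀ p i k → α p i ℕ.< τ k
        α<τ p i k = ℕ.s≤s (ℕ.≤-trans (term≤Σ₂ α p i) (ℕ.m≤m+n K (toℕ k)))

        τ-mono : ∀ {k k′} → toℕ k ℕ.< toℕ k′ → τ k ℕ.< τ k′
        τ-mono k<k′ = ℕ.s<s (ℕ.+-monoʳ-< K k<k′)

        Served : Fin (suc n) → Fin n → Set
        Served k q = q ∈ σ (at (τ k)) × ∃ λ j → Outstanding σ q (arrival J q j) (at (τ k))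

        -- The broadcast at `τ k` clears `q`, and no request arrives afterwards.
        served-once : ∀ {k k′ q} → toℕ k ℕ.< toℕ k′ → Served k q → ¬ Served k′ q
        served-once {k} {k′} {q} k<k′ (q∈σ , _) (_ , j , _ , none) =
          none (at (τ k)) (arrival< (α<τ q j k)) (at-mono-< (τ-mono k<k′)) q∈σ

        -- Some page is broadcast in place of `p`. It has waited at least as long as `p`, hence for
        -- a positive time, hence it is outstanding.
        served : ∀ {p i} k → Outstanding σ p (arrival J p i) (at (τ k)) → p ∉ σ (at (τ k)) → ∃ (Served k)
        served {p} {i} k out p∉σ = q , q∈σ , waiting>0⇒outstanding {q} {τ k}
          (ℕ.≤-trans (outstanding⇒waiting>0 {p} {i} {τ k} out) (skip .proj₂ q q∈σ))
          where
          skip : ∣ σ (at (τ k)) ∣ ≡ 5 × (∀ q → q ∈ σ (at (τ k)) → waiting (τ k) p ℕ.≤ waiting (τ k) q)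
          skip = skipped {p} {i} {τ k} out p∉σ

          page : ∃ (_∈ σ (at (τ k)))
          page = 0<∣S∣⇒nonempty (σ (at (τ k))) (subst (0 ℕ.<_) (sym (skip .proj₁)) (ℕ.s≤s ℕ.z≤n))

          q = page .proj₁
          q∈σ = page .proj₂

        all-served⇒⊥ : (∀ k → ∃ (Served k)) → ⊥
        all-served⇒⊥ all with pigeonhole (ℕ.n<1+n n) (λ k → all k .proj₁)
        ... | k , k′ , k<k′ , q≡q′ =
          served-once {k} {k′} k<k′ (subst (Served k) q≡q′ (all k .proj₂)) (all k′ .proj₂)

        -- After the last arrival, every page broadcast while some request is
        -- outstanding is itself outstanding for the last time. So an
        -- unsatisfied request would leave n + 1 different pages for n + 1 times.
        finishes : ∀ p i → ∃ λ u → IsFinishTime σ p (arrival J p i) (at u)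
        finishes p i = finish (ℕ.anyUpTo? broadcast? b)
          where
          b : ℕ
          b = suc (K ℕ.+ suc n)

          τ<b : ∀ k → τ k ℕ.< b
          τ<b k = ℕ.s<s (ℕ.+-monoʳ-< K (toℕ<n k))

          Broadcast : ℕ → Set
          Broadcast u = α p i ℕ.< u × p ∈ σ (at u)

          broadcast? : ∀ u → Dec (Broadcast u)
          broadcast? u = (α p i ℕ.<? u) ×-dec (p ∈? σ (at u))

          noBroadcast : ∀ u → (∀ v → v ℕ.< u → ¬ Broadcast v) → NoBroadcastBetween σ p (arrival J p i) (at u)
          noBroadcast u none t a<t t<u p∈σt with after-arrival a<t
          ... | v , refl = none v (at-cancel-< t<u) (arrival<⁻¹ a<t , p∈σt)

          never : ¬ (∃ λ u → u ℕ.< b × Broadcast u) → ⊥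
          never none = all-served⇒⊥ λ k → served {p} {i} k
            (arrival< (α<τ p i k) , noBroadcast (τ k) λ v v<τ bc → none (v , ℕ.<-trans v<τ (τ<b k) , bc))
            (λ p∈σ → none (τ k , τ<b k , α<τ p i k , p∈σ))

          finish : Dec (∃ λ u → u ℕ.< b × Broadcast u) → ∃ λ u → IsFinishTime σ p (arrival J p i) (at u)
          finish (no none)  = ⊥-elim (never none)
          finish (yes some) with least broadcast? b some
          ... | u , (α<u , p∈σ) , none = u , arrival< α<u , p∈σ , noBroadcast u none

        -- Finish times under LWF₅.

        φ : ∀ p → Fin (count J p) → ℕ
        φ p i = finishes p i .proj₁

        φ-finish : ∀ p i → IsFinishTime σ p (arrival J p i) (at (φ p i))
        φ-finish p i = finishes p i .proj₂

        outstanding-until-φ : ∀ {p i u} → α p i ℕ.< u → u ℕ.≤ φ p i → Outstanding σ p (arrival J p i) (at u)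
        outstanding-until-φ {p} {i} α<u u≤φ = arrival< α<u , λ t a<t t<u →
          φ-finish p i .proj₂ .proj₂ t a<t (ℤ.<-≤-trans t<u (ℤ.+-monoʳ-≤ T₀ (+≤+ u≤φ)))

        -- At `u` page `p` is outstanding but not broadcast, so exactly five pages are, each with at
        -- least the waiting time of `p`. Their outstanding requests finish at `u`, which turns
        -- waiting time into flow time.
        longest-first : ∀ {p i u} → α p i ℕ.< u → u ℕ.< φ p i →
          5 ℕ.* sum (λ j → if does (u ℕ.≤? φ p j) then u ℕ.∸ α p j else 0) ℕ.≤
          Σ₂ (λ q j → if does (φ q j ℕ.≟ u) then φ q j ℕ.∸ α q j else 0)
        longest-first {p} {i} {u} α<u u<φ = begin
          5 ℕ.* sum (λ j → if does (u ℕ.≤? φ p j) then u ℕ.∸ α p j else 0)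
            ≤⟨ ℕ.*-monoʳ-≤ 5 (sum-mono λ j → if-≤ (u ℕ.≤? φ p j) (counted j)) ⟩
          5 ℕ.* waiting u p
            ≡⟨ cong (ℕ._* waiting u p) (skip .proj₁) ⟨
          ∣ σ (at u) ∣ ℕ.* waiting u p
            ≤⟨ ∣S∣*m≤sum (σ (at u)) (λ q → sum (finished q)) (λ {q} q∈σ →
                 ℕ.≤-trans (skip .proj₂ q q∈σ) (sum-mono λ j → if-≤ (outstandingAt? q j u) (satisfied q∈σ j))) ⟩
          Σ₂ finished ∎
          where
          open ℕ.≤-Reasoning

          finished : ∀ q → Fin (count J q) → ℕ
          finished q j = if does (φ q j ℕ.≟ u) then φ q j ℕ.∸ α q j else 0

          skip : ∣ σ (at u) ∣ ≡ 5 × (∀ q → q ∈ σ (at u) → waiting u p ℕ.≤ waiting u q)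
          skip = skipped (outstanding-until-φ α<u (ℕ.<⇒≤ u<φ))
            (φ-finish p i .proj₂ .proj₂ (at u) (arrival< α<u) (at-mono-< u<φ))

          counted : ∀ j → u ℕ.≤ φ p j →
            u ℕ.∸ α p j ℕ.≤ (if does (outstandingAt? p j u) then u ℕ.∸ α p j else 0)
          counted j u≤φ with α p j ℕ.<? u
          ... | yes αⱼ<u = ≤-if (outstandingAt? p j u) (outstanding-until-φ αⱼ<u u≤φ) ℕ.≤-refl
          ... | no  αⱼ≮u = ℕ.≤-trans (ℕ.≤-reflexive (ℕ.m≤n⇒m∸n≡0 (ℕ.≮⇒≥ αⱼ≮u))) ℕ.z≤n

          satisfied : ∀ {q} → q ∈ σ (at u) → ∀ j → Outstanding σ q (arrival J q j) (at u) →
            u ℕ.∸ α q j ℕ.≤ finished q j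
          satisfied {q} q∈σ j (a<u , none) =
            ≤-if (φ q j ℕ.≟ u) φ≡u (ℕ.≤-reflexive (cong (ℕ._∸ α q j) (sym φ≡u)))
            where
            φ≡u : φ q j ≡ u
            φ≡u = at-injective (finish-shared (φ-finish q j) (a<u , q∈σ , none) a<u (φ-finish q j .proj₁))

        -- Both requests are still outstanding at `t`, so the next broadcast of `p` finishes both.
        φ-shared : ∀ {p i j t} → α p i ℕ.< t → α p j ℕ.< t → t ℕ.< φ p i → t ℕ.< φ p j → φ p i ≡ φ p j
        φ-shared {p} {i} {j} αᵢ<t αⱼ<t t<φᵢ t<φⱼ = at-injective (finish-shared (φ-finish p i) (φ-finish p j)
          (arrival< {p} {i} (ℕ.<-trans αᵢ<t t<φⱼ)) (arrival< {p} {j} (ℕ.<-trans αⱼ<t t<φᵢ)))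

-- The competitive bound.

open import Data.Integer.Base using (ℤ; +_; _*_; _≤_)
open import Data.Nat.Base using (ℕ)
open import Data.Product.Base using (∃; _×_)

theorem2p5 : ∀ (n : ℕ) (J : RequestSequence n) (σ : Schedule n) (opt : ℤ) →
    IsLWF 5 J σ → IsOPT J opt →
    ∃ λ (lwf : ℤ) → HasTotalFlowTime J σ lwf × lwf ≤ + 90 * opt
theorem2p5 n J σ opt lwf ((σ* , speed1 , g , g-finish , opt≡) , _) =
  _ , ((λ p i → at J (φ J σ lwf p i)) , φ-finish J σ lwf , refl) , bound
  where
  -- Finish times come after an arrival, so those of the optimal schedule also have natural
  -- coordinates.
  γ : ∀ p → Fin (count J p) → ℕ
  γ p i = after-arrival J {p} {i} (g-finish p i .proj₁) .proj₁

  g≡γ : ∀ p i → g p i ≡ at J (γ p i)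
  g≡γ p i = after-arrival J {p} {i} (g-finish p i .proj₁) .proj₂

  γ-finish : ∀ p i → IsFinishTime σ* p (arrival J p i) (at J (γ p i))
  γ-finish p i = subst (IsFinishTime σ* p (arrival J p i)) (g≡γ p i) (g-finish p i)

  α<γ : ∀ p i → α J p i ℕ.< γ p i
  α<γ p i = arrival<⁻¹ J {p} {i} (γ-finish p i .proj₁)

  same-page : ∀ {p q i j} → γ p i ≡ γ q j → p ≡ q
  -- Both pages are broadcast by the optimal schedule at this one time, and speed 1 allows only one
  -- page.
  same-page {p} {q} {i} {j} γ≡γ = ∣S∣≤1⇒unique (speed1 (at J (γ p i)))
    (γ-finish p i .proj₂ .proj₁)
    (subst (λ t → q ∈ σ* (at J t)) (sym γ≡γ) (γ-finish q j .proj₂ .proj₁))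

  same-finish : ∀ {p i j} → γ p i ≡ γ p j → γ p i ℕ.< φ J σ lwf p i → γ p j ℕ.< φ J σ lwf p j →
    φ J σ lwf p i ≡ φ J σ lwf p j
  same-finish {p} {i} {j} γ≡γ γᵢ<φᵢ γⱼ<φⱼ = φ-shared J σ lwf {p} {i} {j} {γ p i} (α<γ p i)
    (subst (α J p j ℕ.<_) (sym γ≡γ) (α<γ p j)) γᵢ<φᵢ (subst (ℕ._< φ J σ lwf p j) (sym γ≡γ) γⱼ<φⱼ)

  open Charging (α J) (φ J σ lwf) γ α<γ (λ {p} {q} {i} {j} → same-page {p} {q} {i} {j})
    (λ {p} {i} {j} → same-finish {p} {i} {j}) (λ {p} {i} {u} → longest-first J σ lwf {p} {i} {u})

  opt≡flowγ : opt ≡ + Σ₂ flowγ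
  opt≡flowγ = trans opt≡ (trans
    (sum-cong-≗ λ p → sum-cong-≗ λ i → cong (ℤ._- arrival J p i) (g≡γ p i))
    (flow≡ J γ γ-finish))
    where open Algebra.Properties.Semiring.Sum ℤ.+-*-semiring using (sum-cong-≗)

  bound : Σℤ (λ p → Σℤ (λ i → at J (φ J σ lwf p i) ℤ.- arrival J p i)) ≤ + 90 * opt
  bound = begin
    Σℤ (λ p → Σℤ (λ i → at J (φ J σ lwf p i) ℤ.- arrival J p i)) ≡⟨ flow≡ J (φ J σ lwf) (φ-finish J σ lwf) ⟩
    + Σ₂ flowφ                  ≤⟨ ℤ.+≤+ flowφ≤5*flowγ ⟩
    -- The charging gives the factor 5, which is weakened to 90 = 5 + 85.
    + (5 ℕ.* Σ₂ flowγ)          ≤⟨ ℤ.+≤+ (ℕ.*-monoˡ-≤ (Σ₂ flowγ) (ℕ.m≤m+n 5 85)) ⟩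
    + (90 ℕ.* Σ₂ flowγ)         ≡⟨ ℤ.pos-* 90 (Σ₂ flowγ) ⟩
    + 90 * + Σ₂ flowγ           ≡⟨ cong (+ 90 *_) opt≡flowγ ⟨
    + 90 * opt                  ∎
    where open ℤ.≤-Reasoning
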